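{- Let $\mathcal{A}$ be a minimally self-adjusting BST algorithm. Suppose there are a constant $C$ and a function $f:\mathbb{N}\to\mathbb{N}$ with $f(N)=N^{o(1)}$ (i.e. $\log f(N)/\log N\to0$) such that whenever $\mathcal{A}$ is executed on a BST $T$, every after-tree $A$ it creates satisfies: (i) the nodes of $A$ other than its root can be partitioned into at most $C$ monotone sets, and (ii) $A$ has at most $f(|T|)$ leaves. Then $\mathcal{A}$ does not satisfy the sequential access theorem.
   Context: A minimally self-adjusting BST algorithm, on access to $s$ in the current BST $T$ with search path $P$ (nodes on the root-to-$s$ path including $s$), replaces $P$ by a BST $A$ on node set $P$ with root $s$ (the after-tree), reattaching the subtrees hanging off $P$ in the unique order-consistent way; the cost of the access is $|P|$. A subset $X\subseteq P$ is monotone if either all its elements are larger than $s$ and have the same right-depth in $A$, or all are smaller than $s$ and have the same left-depth in $A$ (right-/left-depth: number of right-/left-going edges on the root-to-node path). An algorithm satisfies the sequential access theorem if there is a constant $K$ such that, starting from an arbitrary initial BST $T$, it accesses all elements of $T$ in increasing order with total cost at most $K|T|$. -}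

module Defs where

open import Data.Nat using (ℕ; zero; suc; _+_; _*_; _^_; _≤_; _<_)
open import Data.Nat.Properties using (<-cmp)
open import Data.Fin using (Fin)
open import Data.List using (List; []; _∷_; _++_; [_]; length)
open import Data.List.Membership.Propositional using (_∈_)
open import Data.List.Relation.Unary.AllPairs using (AllPairs)
open import Data.List.Relation.Binary.Permutation.Propositional using (_↭_)
open import Data.Product using (Σ; ∃; ∃-syntax; _×_; _,_; proj₁)
open import Data.Sum using (_⊎_)
open import Relation.Binary using (tri<; tri≈; tri>)
open import Relation.Binary.PropositionalEquality using (_≡_; _≢_)
open import Relation.Nullary using (¬_)

data Tree : Set where
  leaf : Tree
  node : Tree → ℕ → Tree → Tree

inorder : Tree → List ℕ
inorder leaf         = []
inorder (node l k r) = inorder l ++ (k ∷ inorder r)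

size : Tree → ℕ
size leaf         = 0
size (node l _ r) = size l + suc (size r)

IsBST : Tree → Set
IsBST t = AllPairs _<_ (inorder t)

data HasRoot : Tree → ℕ → Set where
  root : ∀ {l k r} → HasRoot (node l k r) k

leaves : Tree → ℕ
leaves leaf                       = 0
leaves (node leaf _ leaf)         = 1
leaves (node leaf _ (node a b c)) = leaves (node a b c)
leaves (node (node a b c) _ r)    = leaves (node a b c) + leaves r

path : ℕ → Tree → List ℕ
path s leaf = []
path s (node l k r) with <-cmp s k
... | tri< _ _ _ = k ∷ path s l
... | tri≈ _ _ _ = k ∷ []
... | tri> _ _ _ = k ∷ path s r

hanging : ℕ → Tree → List Tree
hanging s leaf = leaf ∷ []
hanging s (node l k r) with <-cmp s k
... | tri< _ _ _ = hanging s l ++ (r ∷ [])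
... | tri≈ _ _ _ = l ∷ r ∷ []
... | tri> _ _ _ = l ∷ hanging s r

fill : Tree → List Tree → Tree × List Tree
fill leaf []       = leaf , []
fill leaf (t ∷ ts) = t , ts
fill (node l k r) ts with fill l ts
... | l' , ts₁ with fill r ts₁
... | r' , ts₂ = node l' k r' , ts₂

access : Tree → ℕ → Tree → Tree
access T s A = proj₁ (fill A (hanging s T))

ValidAfter : Tree → ℕ → Tree → Set
ValidAfter T s A = IsBST A × (inorder A ↭ path s T) × HasRoot A s

-- (Deterministic, online) minimally self-adjusting BST algorithms.
-- The after-tree may depend on the initial tree, the sequence of keys
-- accessed so far, the current tree and the key being accessed.

record Algorithm : Set where
  field
    after : (T₀ : Tree) (history : List ℕ) (T : Tree) (s : ℕ) → Tree

open Algorithm public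

data Reach (𝒜 : Algorithm) (T₀ : Tree) : List ℕ → Tree → Set where
  start : Reach 𝒜 T₀ [] T₀
  step  : ∀ {h T} → Reach 𝒜 T₀ h T → (s : ℕ) → s ∈ inorder T →
          Reach 𝒜 T₀ (h ++ [ s ]) (access T s (after 𝒜 T₀ h T s))

MinimallySelfAdjusting : Algorithm → Set
MinimallySelfAdjusting 𝒜 =
  ∀ T₀ → IsBST T₀ → ∀ {h T} → Reach 𝒜 T₀ h T →
  ∀ s → s ∈ inorder T → ValidAfter T s (after 𝒜 T₀ h T s)

runCost : Algorithm → (T₀ : Tree) → List ℕ → Tree → List ℕ → ℕ
runCost 𝒜 T₀ h T []       = 0
runCost 𝒜 T₀ h T (s ∷ ss) =
  length (path s T) + runCost 𝒜 T₀ (h ++ [ s ]) (access T s (after 𝒜 T₀ h T s)) ss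

SequentialAccess : Algorithm → Set
SequentialAccess 𝒜 =
  ∃[ K ] (∀ T → IsBST T → runCost 𝒜 T [] T (inorder T) ≤ K * size T)

-- right-depth / left-depth of key x in A (number of right/left edges
-- on the root-to-x path; A is a BST so this is the search path)
rdepth : ℕ → Tree → ℕ
rdepth x leaf = 0
rdepth x (node l k r) with <-cmp x k
... | tri< _ _ _ = rdepth x l
... | tri≈ _ _ _ = 0
... | tri> _ _ _ = suc (rdepth x r)

ldepth : ℕ → Tree → ℕ
ldepth x leaf = 0
ldepth x (node l k r) with <-cmp x k
... | tri< _ _ _ = suc (ldepth x l)
... | tri≈ _ _ _ = 0
... | tri> _ _ _ = ldepth x r

Monotone : ℕ → Tree → (ℕ → Set) → Set
Monotone s A X =
  ((∀ x → X x → s < x) × (∀ x y → X x → X y → rdepth x A ≡ rdepth y A))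
  ⊎ ((∀ x → X x → x < s) × (∀ x y → X x → X y → ldepth x A ≡ ldepth y A))

MonotonePartition : ℕ → ℕ → Tree → Set
MonotonePartition C s A =
  Σ (ℕ → Fin C) λ col → ∀ (i : Fin C) →
    Monotone s A (λ x → (x ∈ inorder A) × (x ≢ s) × (col x ≡ i))

-- f(N) = N^{o(1)}: for every k ≥ 1, eventually f(N)^k ≤ N
SubPolynomial : (ℕ → ℕ) → Set
SubPolynomial f = ∀ k → 1 ≤ k → ∃[ N₀ ] (∀ N → N₀ ≤ N → f N ^ k ≤ N)

{-# OPTIONS --safe #-}
-- Call keys x < y chained if x is on the left spine of the left subtree of y.
-- When keys are accessed in increasing order, the remaining keys of a chain are
-- touched (lie on the search path) all together or not at all; an untouched
-- chain stays a chain, and a touched one is split by the after-tree into at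
-- most b = C * f n chains, since two keys larger than the root that have the
-- same right-depth and lie above a common leaf are chained.  Recording the part
-- a key goes to at each of its touches thus gives n distinct prefix-free words
-- over b + 1 letters when the initial tree is a left path, and so a total cost
-- of order n log n / log (b + 1), which is superlinear for b = n ^ o(1).
module Submission where

open import Defs
open import Data.Nat using (ℕ; zero; suc; _+_; _*_; _^_; _⊔_; _≤_; _<_; s≤s; z≤n; NonZero; >-nonZero)
open import Data.Nat.Properties
open import Data.Bool using (true; false; if_then_else_)
open import Data.Fin using (toℕ)
open import Data.Fin.Properties using (toℕ-injective; toℕ<n)
open import Data.List using (List; []; _∷_; _++_; [_]; length; map; filter)
open import Data.Nat.ListAction using (sum)
open import Algebra.Properties.CommutativeSemigroup +-commutativeSemigroup
  using (x∙yz≈y∙xz) renaming (interchange to medial)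
open import Data.List.Membership.DecPropositional _≟_ using (_∈?_)
open import Data.List.Properties using (length-++; ++-assoc; ++-identityʳ)
open import Data.List.Membership.Propositional using (_∈_; _∉_)
open import Data.List.Membership.Propositional.Properties using (∈-++⁻; ∈-++⁺ˡ; ∈-++⁺ʳ; ∈-insert; ∈-filter⁻; ∈-∃++)
open import Data.List.Relation.Unary.Any using (Any; here; there)
import Data.List.Relation.Unary.Any.Properties as Any
open import Data.List.Relation.Unary.All as All using (All; []; _∷_)
import Data.List.Relation.Unary.All.Properties as All
open import Data.List.Relation.Unary.AllPairs as AllPairs using (AllPairs; []; _∷_)
import Data.List.Relation.Unary.AllPairs.Properties as AllPairs
open import Data.List.Relation.Unary.Linked.Properties using (AllPairs⇒Linked)
open import Data.List.Relation.Unary.Sorted.TotalOrder.Properties using (↗↭↗⇒≋)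
open import Data.List.Relation.Binary.Pointwise using (Pointwise-≡⇒≡)
open import Data.List.Relation.Binary.Permutation.Propositional
  using (_↭_; ↭-refl; ↭-sym; ↭-trans; prep; ↭⇒↭ₛ)
open import Data.List.Relation.Binary.Permutation.Propositional.Properties
  using (↭-length; ++-comm; ∈-resp-↭; shift)
open import Data.Product using (∃-syntax; _×_; _,_; proj₁; proj₂)
open import Data.Sum using (_⊎_; inj₁; inj₂)
open import Relation.Binary using (Rel; tri<; tri≈; tri>)
open import Relation.Binary.PropositionalEquality hiding ([_])
open import Relation.Nullary using (¬_; contradiction; Dec; yes; no; does)
open import Relation.Unary using (Decidable)
open import Relation.Unary.Properties using (∁?)

private variable
  s x y : ℕ
  A t : Tree
  us : List Tree

-- Sorted lists and search trees.

allPairs-++⁻ : ∀ {a ℓ} {X : Set a} {R : Rel X ℓ} xs {ys} → AllPairs R (xs ++ ys) →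
  AllPairs R xs × All (λ x → All (R x) ys) xs × AllPairs R ys
allPairs-++⁻ []       p = [] , [] , p
allPairs-++⁻ (x ∷ xs) (px ∷ p) with allPairs-++⁻ xs p
... | q , c , r = All.++⁻ˡ xs px ∷ q , All.++⁻ʳ xs px ∷ c , r

sorted-↭⇒≡ : ∀ {xs ys} → AllPairs _<_ xs → AllPairs _<_ ys → xs ↭ ys → xs ≡ ys
sorted-↭⇒≡ xs↗ ys↗ p = Pointwise-≡⇒≡ (↗↭↗⇒≋ ≤-totalOrder (sorted xs↗) (sorted ys↗) (↭⇒↭ₛ p))
  where sorted = λ {zs} (zs↗ : AllPairs _<_ zs) → AllPairs⇒Linked (AllPairs.map <⇒≤ zs↗)

-- IsBST computes to a statement about inorder, from which Agda cannot recover
-- the tree; this equivalent predicate is indexed by the tree itself.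
data Ordered : Tree → Set where
  leaf : Ordered leaf
  node : ∀ {l k r} → Ordered l → All (_< k) (inorder l) → All (k <_) (inorder r) → Ordered r →
         Ordered (node l k r)

ordered : ∀ t → IsBST t → Ordered t
ordered leaf         b = leaf
ordered (node l k r) b with allPairs-++⁻ (inorder l) b
... | bˡ , l<kr , k<r ∷ bʳ = node (ordered l bˡ) (All.map All.head l<kr) k<r (ordered r bʳ)

module _ {l r : Tree} {k : ℕ} where

  orderedˡ : Ordered (node l k r) → Ordered l
  orderedˡ (node oˡ _ _ _) = oˡ

  orderedʳ : Ordered (node l k r) → Ordered r
  orderedʳ (node _ _ _ oʳ) = oʳ

  left< : Ordered (node l k r) → x ∈ inorder l → x < k
  left< (node _ l<k _ _) = All.lookup l<k

  <right : Ordered (node l k r) → x ∈ inorder r → k < x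
  <right (node _ _ k<r _) = All.lookup k<r

  ∈ˡ : Ordered (node l k r) → x ∈ inorder (node l k r) → x < k → x ∈ inorder l
  ∈ˡ o x∈ x<k with ∈-++⁻ (inorder l) x∈
  ... | inj₁ p           = p
  ... | inj₂ (here refl) = contradiction x<k (<-irrefl refl)
  ... | inj₂ (there p)   = contradiction x<k (<-asym (<right o p))

  ∈ʳ : Ordered (node l k r) → x ∈ inorder (node l k r) → k < x → x ∈ inorder r
  ∈ʳ o x∈ k<x with ∈-++⁻ (inorder l) x∈
  ... | inj₁ p           = contradiction k<x (<-asym (left< o p))
  ... | inj₂ (here refl) = contradiction k<x (<-irrefl refl)
  ... | inj₂ (there p)   = p

-- Search paths and chains.

path⊆inorder : ∀ s t → x ∈ path s t → x ∈ inorder t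
path⊆inorder s (node l k r) x∈ with <-cmp s k | x∈
... | tri< _ _ _ | here refl = ∈-insert (inorder l)
... | tri< _ _ _ | there p   = ∈-++⁺ˡ (path⊆inorder s l p)
... | tri≈ _ _ _ | here refl = ∈-insert (inorder l)
... | tri> _ _ _ | here refl = ∈-insert (inorder l)
... | tri> _ _ _ | there p   = ∈-++⁺ʳ (inorder l) (there (path⊆inorder s r p))

∈path : ∀ s t → Ordered t → s ∈ inorder t → s ∈ path s t
∈path s leaf o ()
∈path s (node l k r) o s∈ with <-cmp s k
... | tri< s<k _ _ = there (∈path s l (orderedˡ o) (∈ˡ o s∈ s<k))
... | tri≈ _ s≡k _ = here s≡k
... | tri> _ _ k<s = there (∈path s r (orderedʳ o) (∈ʳ o s∈ k<s))

data LeftSpine (x : ℕ) : Tree → Set where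
  top  : ∀ {l r} → LeftSpine x (node l x r)
  down : ∀ {l k r} → LeftSpine x l → LeftSpine x (node l k r)

data Chain (x y : ℕ) : Tree → Set where
  top : ∀ {l r} → LeftSpine x l → Chain x y (node l y r)
  inˡ : ∀ {l k r} → Chain x y l → Chain x y (node l k r)
  inʳ : ∀ {l k r} → Chain x y r → Chain x y (node l k r)

spine∈ : LeftSpine x t → x ∈ inorder t
spine∈ {t = node l _ _} top      = ∈-insert (inorder l)
spine∈                  (down p) = ∈-++⁺ˡ (spine∈ p)

chain∈ : Chain x y t → x ∈ inorder t × y ∈ inorder t
chain∈ {t = node l _ _} (top p) = ∈-++⁺ˡ (spine∈ p) , ∈-insert (inorder l)
chain∈ (inˡ c) = ∈-++⁺ˡ (proj₁ (chain∈ c)) , ∈-++⁺ˡ (proj₂ (chain∈ c))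
chain∈ {t = node l _ _} (inʳ c) =
  ∈-++⁺ʳ (inorder l) (there (proj₁ (chain∈ c))) , ∈-++⁺ʳ (inorder l) (there (proj₂ (chain∈ c)))

chain⇒< : Ordered t → Chain x y t → x < y
chain⇒< o (top p) = left< o (spine∈ p)
chain⇒< o (inˡ c) = chain⇒< (orderedˡ o) c
chain⇒< o (inʳ c) = chain⇒< (orderedʳ o) c

-- Every proper ancestor of `x` on the left spine exceeds `x`, hence `s`, so the search turns left
-- at each of them and arrives at `x`.
spine⇒∈path : Ordered t → s ≤ x → LeftSpine x t → x ∈ path s t
spine⇒∈path {node l k r} {s} o s≤x p with <-cmp s k | p
... | tri< _ _ _ | top    = here refl
... | tri≈ _ _ _ | top    = here refl
... | tri> _ _ _ | top    = here refl
... | tri< _ _ _ | down q = there (spine⇒∈path (orderedˡ o) s≤x q)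
... | tri≈ s≮k _ _ | down q = contradiction (≤-<-trans s≤x (left< o (spine∈ q))) s≮k
... | tri> s≮k _ _ | down q = contradiction (≤-<-trans s≤x (left< o (spine∈ q))) s≮k

-- After visiting `y` the search turns left, as `s ≤ x < y`, and follows the left spine at least as
-- far as `x`. Increasing accesses supply `s ≤ x`.
chain-touched-down : Ordered t → s ≤ x → Chain x y t → y ∈ path s t → x ∈ path s t
chain-touched-down {node l k r} {s} o s≤x (top p) y∈ = spine⇒∈path o s≤x (down p)
chain-touched-down {node l k r} {s} o s≤x (inˡ c) y∈ with <-cmp s k | y∈
... | tri< _ _ _ | there q   = there (chain-touched-down (orderedˡ o) s≤x c q)
... | tri< _ _ _ | here refl = contradiction (left< o (proj₂ (chain∈ c))) (<-irrefl refl)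
... | tri≈ s≮k _ _ | _ = contradiction (≤-<-trans s≤x (left< o (proj₁ (chain∈ c)))) s≮k
... | tri> s≮k _ _ | _ = contradiction (≤-<-trans s≤x (left< o (proj₁ (chain∈ c)))) s≮k
chain-touched-down {node l k r} {s} o s≤x (inʳ c) y∈ with <-cmp s k | y∈
... | tri> _ _ _ | there q   = there (chain-touched-down (orderedʳ o) s≤x c q)
... | tri> _ _ _ | here refl = contradiction (<right o (proj₂ (chain∈ c))) (<-irrefl refl)
... | tri< _ _ _ | here refl = contradiction (<right o (proj₂ (chain∈ c))) (<-irrefl refl)
... | tri≈ _ _ _ | here refl = contradiction (<right o (proj₂ (chain∈ c))) (<-irrefl refl)
... | tri< _ _ _ | there q   =
  contradiction (<right o (proj₂ (chain∈ c))) (<-asym (left< o (path⊆inorder s l q)))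

-- The key `y` is an ancestor of `x`, and a search path contains all ancestors of its keys.
chain-touched-up : Ordered t → Chain x y t → x ∈ path s t → y ∈ path s t
chain-touched-up {node l k r} {s = s} o (top p) x∈ with <-cmp s k
... | tri< _ _ _ = here refl
... | tri≈ _ _ _ = here refl
... | tri> _ _ _ = here refl
chain-touched-up {node l k r} {s = s} o (inˡ c) x∈ with <-cmp s k | x∈
... | tri< _ _ _ | there q   = there (chain-touched-up (orderedˡ o) c q)
... | tri< _ _ _ | here refl = contradiction (left< o (proj₁ (chain∈ c))) (<-irrefl refl)
... | tri≈ _ _ _ | here refl = contradiction (left< o (proj₁ (chain∈ c))) (<-irrefl refl)
... | tri> _ _ _ | here refl = contradiction (left< o (proj₁ (chain∈ c))) (<-irrefl refl)
... | tri> _ _ _ | there q   =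
  contradiction (left< o (proj₁ (chain∈ c))) (<-asym (<right o (path⊆inorder s r q)))
chain-touched-up {node l k r} {s = s} o (inʳ c) x∈ with <-cmp s k | x∈
... | tri> _ _ _ | there q   = there (chain-touched-up (orderedʳ o) c q)
... | tri> _ _ _ | here refl = contradiction (<right o (proj₁ (chain∈ c))) (<-irrefl refl)
... | tri≈ _ _ _ | here refl = contradiction (<right o (proj₁ (chain∈ c))) (<-irrefl refl)
... | tri< _ _ _ | here refl = contradiction (<right o (proj₁ (chain∈ c))) (<-irrefl refl)
... | tri< _ _ _ | there q   =
  contradiction (<right o (proj₁ (chain∈ c))) (<-asym (left< o (path⊆inorder s l q)))

-- When the search misses `y`, the whole subtree rooted at `y`, with `x` in it, lies inside one
-- hanging tree.
chain-untouched : Chain x y t → y ∉ path s t → Any (Chain x y) (hanging s t)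
chain-untouched {t = node l k r} {s} c y∉ with <-cmp s k | c
... | tri< _ _ _ | top _ = contradiction (here refl) y∉
... | tri≈ _ _ _ | top _ = contradiction (here refl) y∉
... | tri> _ _ _ | top _ = contradiction (here refl) y∉
... | tri< _ _ _ | inˡ d = Any.++⁺ˡ (chain-untouched d (λ p → y∉ (there p)))
... | tri≈ _ _ _ | inˡ d = here d
... | tri> _ _ _ | inˡ d = here d
... | tri< _ _ _ | inʳ d = Any.++⁺ʳ (hanging s l) (here d)
... | tri≈ _ _ _ | inʳ d = there (here d)
... | tri> _ _ _ | inʳ d = there (chain-untouched d (λ p → y∉ (there p)))

-- Attaching the hanging trees to the after-tree.

data Fills : Tree → List Tree → Tree → Set where
  leaf : Fills leaf [ t ] t
  node : ∀ {l k r us vs l′ r′} → Fills l us l′ → Fills r vs r′ →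
         Fills (node l k r) (us ++ vs) (node l′ k r′)

fills-length : Fills A us t → length us ≡ suc (length (inorder A))
fills-length leaf = refl
fills-length {A = node l k r} (node {us = us} {vs} p q) = begin
  length (us ++ vs)                                   ≡⟨ length-++ us ⟩
  length us + length vs                               ≡⟨ cong₂ _+_ (fills-length p) (fills-length q) ⟩
  suc (length (inorder l) + suc (length (inorder r))) ≡⟨ cong suc (length-++ (inorder l)) ⟨
  suc (length (inorder (node l k r)))                 ∎
  where open ≡-Reasoning

-- A tree with m keys has m + 1 empty positions, so a list of at least that many trees never runs
-- out and the default case of `fill` is not reached. `Fills` keeps exactly the trees consumed,
-- which frees later inductions from the leftover list.
fill-fills : ∀ A ts → length (inorder A) < length ts →
  ∃[ us ] ∃[ rest ] ∃[ t ] ts ≡ us ++ rest × fill A ts ≡ (t , rest) × Fills A us t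
fill-fills leaf (t ∷ ts) _ = [ t ] , ts , t , refl , refl , leaf
fill-fills (node l k r) ts len
  with fill-fills l ts (≤-<-trans (≤-trans (m≤m+n _ _) (≤-reflexive (sym (length-++ (inorder l))))) len)
... | us , ts′ , l′ , refl , eq , p
  with fill-fills r ts′ (+-cancelˡ-≤ (suc (length (inorder l))) _ _
    (subst₂ (λ m n → suc m ≤ n) (length-++ (inorder l))
      (trans (length-++ us) (cong (_+ length ts′) (fills-length p))) len))
... | vs , rest , r′ , refl , eq′ , q rewrite eq | eq′ =
  us ++ vs , rest , node l′ k r′ , sym (++-assoc us vs rest) , refl , node p q

length-hanging : ∀ s t → length (hanging s t) ≡ suc (length (path s t))
length-hanging s leaf = refl
length-hanging s (node l k r) with <-cmp s k
... | tri< _ _ _ = trans (length-++ (hanging s l)) (trans (+-comm _ 1) (cong suc (length-hanging s l)))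
... | tri≈ _ _ _ = refl
... | tri> _ _ _ = cong suc (length-hanging s r)

-- A path of m keys leaves m + 1 hanging trees, and the after-tree has the same m keys, so its empty
-- positions match the hanging trees exactly.
access-fills : ∀ t s → ValidAfter t s A → Fills A (hanging s t) (access t s A)
access-fills {A} t s (_ , perm , _)
  with len ← trans (length-hanging s t) (cong suc (sym (↭-length perm)))
  with fill-fills A (hanging s t) (≤-reflexive (sym len))
... | us , [] , t′ , eq , eq′ , p rewrite eq′ | eq | ++-identityʳ us = p
... | us , u ∷ rest , t′ , eq , eq′ , p = contradiction
  (trans (sym (length-++ us)) (trans (sym (cong length eq)) (trans len (sym (fills-length p)))))
  (m+1+n≢m (length us))

-- Filling replaces only empty subtrees, so the edges between keys of `A` survive.
fills-spine : Fills A us t → LeftSpine x A → LeftSpine x t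
fills-spine (node p q) top      = top
fills-spine (node p q) (down c) = down (fills-spine p c)

fills-chain : Fills A us t → Chain x y A → Chain x y t
fills-chain (node p q) (top c) = top (fills-spine p c)
fills-chain (node p q) (inˡ c) = inˡ (fills-chain p c)
fills-chain (node p q) (inʳ c) = inʳ (fills-chain q c)

fills-hung-chain : Fills A us t → Any (Chain x y) us → Chain x y t
fills-hung-chain leaf (here c) = c
fills-hung-chain (node {us = us} p q) c with Any.++⁻ us c
... | inj₁ d = inˡ (fills-hung-chain p d)
... | inj₂ d = inʳ (fills-hung-chain q d)

-- Accesses preserve the inorder sequence.

-- Only meaningful when there is one more tree than keys.
weave : List ℕ → List Tree → List ℕ
weave ps       []       = ps
weave []       (t ∷ _)  = inorder t
weave (p ∷ ps) (t ∷ ts) = inorder t ++ p ∷ weave ps ts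

weave-++ : ∀ ps {k qs} us {vs} → length us ≡ suc (length ps) →
  weave (ps ++ k ∷ qs) (us ++ vs) ≡ weave ps us ++ k ∷ weave qs vs
weave-++ []       (t ∷ [])     _  = refl
weave-++ (p ∷ ps) (t ∷ us) len =
  trans (cong (λ zs → inorder t ++ p ∷ zs) (weave-++ ps us (suc-injective len)))
        (sym (++-assoc (inorder t) _ _))

fills-inorder : Fills A us t → inorder t ≡ weave (inorder A) us
fills-inorder leaf = refl
fills-inorder {A = node l k r} (node {us = us} p q) = trans
  (cong₂ (λ xs ys → xs ++ k ∷ ys) (fills-inorder p) (fills-inorder q))
  (sym (weave-++ (inorder l) us (fills-length p)))

-- The search path in key order: a key at which the search turns left exceeds all later ones and
-- therefore goes last.
sortedPath : ℕ → Tree → List ℕ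
sortedPath s leaf = []
sortedPath s (node l k r) with <-cmp s k
... | tri< _ _ _ = sortedPath s l ++ [ k ]
... | tri≈ _ _ _ = [ k ]
... | tri> _ _ _ = k ∷ sortedPath s r

sortedPath↭path : ∀ s t → sortedPath s t ↭ path s t
sortedPath↭path s leaf = ↭-refl
sortedPath↭path s (node l k r) with <-cmp s k
... | tri< _ _ _ = ↭-trans (++-comm (sortedPath s l) [ k ]) (prep k (sortedPath↭path s l))
... | tri≈ _ _ _ = ↭-refl
... | tri> _ _ _ = prep k (sortedPath↭path s r)

sortedPath⊆inorder : ∀ s t → x ∈ sortedPath s t → x ∈ inorder t
sortedPath⊆inorder s t x∈ = path⊆inorder s t (∈-resp-↭ (sortedPath↭path s t) x∈)

sortedPath-sorted : ∀ s t → Ordered t → AllPairs _<_ (sortedPath s t)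
sortedPath-sorted s leaf o = []
sortedPath-sorted s (node l k r) o with <-cmp s k
... | tri< _ _ _ = AllPairs.++⁺ (sortedPath-sorted s l (orderedˡ o)) ([] ∷ [])
  (All.tabulate (λ x∈ → left< o (sortedPath⊆inorder s l x∈) ∷ []))
... | tri≈ _ _ _ = [] ∷ []
... | tri> _ _ _ = All.tabulate (λ x∈ → <right o (sortedPath⊆inorder s r x∈)) ∷ sortedPath-sorted s r (orderedʳ o)

inorder≡weave : ∀ s t → inorder t ≡ weave (sortedPath s t) (hanging s t)
inorder≡weave s leaf = refl
inorder≡weave s (node l k r) with <-cmp s k
... | tri< _ _ _ = trans (cong (_++ k ∷ inorder r) (inorder≡weave s l))
  (sym (weave-++ (sortedPath s l) (hanging s l)
    (trans (length-hanging s l) (cong suc (sym (↭-length (sortedPath↭path s l)))))))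
... | tri≈ _ _ _ = refl
... | tri> _ _ _ = cong (λ zs → inorder l ++ k ∷ zs) (inorder≡weave s r)

-- Both trees interleave the same hanging trees with the same keys, because a sorted permutation of
-- the path is unique. Hence every tree reached keeps the initial keys and the search order.
inorder-access : IsBST t → ValidAfter t s A → inorder (access t s A) ≡ inorder t
inorder-access {t} {s} {A} b valid@(bA , perm , _) = begin
  inorder (access t s A)               ≡⟨ fills-inorder (access-fills t s valid) ⟩
  weave (inorder A) (hanging s t)      ≡⟨ cong (λ ps → weave ps (hanging s t)) A≡path ⟩
  weave (sortedPath s t) (hanging s t) ≡⟨ inorder≡weave s t ⟨
  inorder t                            ∎
  where
  open ≡-Reasoning
  A≡path = sorted-↭⇒≡ bA (sortedPath-sorted s t (ordered t b)) (↭-trans perm (↭-sym (sortedPath↭path s t)))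

-- Right-depth and leaf position as labels for chains.

-- The position, from the left, of the leftmost leaf of the subtree at x.
leafIndex : ℕ → Tree → ℕ
leafIndex x leaf = 0
leafIndex x (node l k r) with <-cmp x k
... | tri< _ _ _ = leafIndex x l
... | tri≈ _ _ _ = 0
... | tri> _ _ _ = leaves l + leafIndex x r

-- Equality fails only at a single node, which is itself a leaf although its subtrees have none.
leaves-node : ∀ l k r → leaves l + leaves r ≤ leaves (node l k r)
leaves-node leaf           k leaf         = z≤n
leaves-node leaf           k (node _ _ _) = ≤-refl
leaves-node (node _ _ _)   k r            = ≤-refl

0<leaves : ∀ l k r → 0 < leaves (node l k r)
0<leaves leaf         k leaf         = s≤s z≤n
0<leaves leaf         k (node a b c) = 0<leaves a b c
0<leaves (node a b c) k r            = ≤-trans (0<leaves a b c) (m≤m+n _ _)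

leafIndex<leaves : ∀ t → Ordered t → x ∈ inorder t → leafIndex x t < leaves t
leafIndex<leaves {x} (node l k r) o x∈ with <-cmp x k
... | tri< x<k _ _ = ≤-trans (leafIndex<leaves l (orderedˡ o) (∈ˡ o x∈ x<k))
                             (≤-trans (m≤m+n _ _) (leaves-node l k r))
... | tri≈ _ _ _ = 0<leaves l k r
... | tri> _ _ k<x = ≤-trans (+-monoʳ-< (leaves l) (leafIndex<leaves r (orderedʳ o) (∈ʳ o x∈ k<x)))
                             (leaves-node l k r)

rdepth≡0⇒spine : ∀ t → Ordered t → x ∈ inorder t → rdepth x t ≡ 0 → LeftSpine x t
rdepth≡0⇒spine {x} (node l k r) o x∈ eq with <-cmp x k
... | tri< x<k _ _ = down (rdepth≡0⇒spine l (orderedˡ o) (∈ˡ o x∈ x<k) eq)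
... | tri≈ _ refl _ = top
rdepth≡0⇒spine {x} (node l k r) o x∈ () | tri> _ _ _

-- Equal leaf positions keep `x` and `y` from lying on opposite sides of a common ancestor; equal
-- right-depths keep `y` out of the right subtree of `x`. What remains is `x` below `y` on the left,
-- reached from there without a right turn.
labels⇒chain : ∀ t → Ordered t → x ∈ inorder t → y ∈ inorder t → x < y →
  rdepth x t ≡ rdepth y t → leafIndex x t ≡ leafIndex y t → Chain x y t
labels⇒chain {x} {y} (node l k r) o x∈ y∈ x<y d i with <-cmp x k | <-cmp y k
... | tri< x<k _ _ | tri< y<k _ _ = inˡ (labels⇒chain l (orderedˡ o) (∈ˡ o x∈ x<k) (∈ˡ o y∈ y<k) x<y d i)
... | tri< x<k _ _ | tri≈ _ refl _ = top (rdepth≡0⇒spine l (orderedˡ o) (∈ˡ o x∈ x<k) d)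
-- The leaf position of `x` is below `leaves l`, that of `y` is not.
... | tri< x<k _ _ | tri> _ _ _ = contradiction
  (<-≤-trans (leafIndex<leaves l (orderedˡ o) (∈ˡ o x∈ x<k)) (m≤m+n _ _)) (<-irrefl i)
... | tri≈ _ refl _ | tri< y<k _ _ = contradiction y<k (<-asym x<y)
... | tri≈ _ refl _ | tri≈ _ refl _ = contradiction x<y (<-irrefl refl)
labels⇒chain (node l k r) o x∈ y∈ x<y () i | tri≈ _ _ _ | tri> _ _ _
... | tri> _ _ k<x | tri< y<k _ _ = contradiction y<k (<-asym (<-trans k<x x<y))
... | tri> _ _ k<x | tri≈ _ refl _ = contradiction x<y (<-asym k<x)
... | tri> _ _ k<x | tri> _ _ k<y = inʳ (labels⇒chain r (orderedʳ o) (∈ʳ o x∈ k<x) (∈ʳ o y∈ k<y) x<y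
  (suc-injective d) (+-cancelˡ-≡ (leaves l) _ _ i))

-- Sums over lists and over label classes.

module _ (g : ℕ → ℕ) where

  total : List ℕ → ℕ
  total X = sum (map g X)

  total-split : ∀ {p} {P : ℕ → Set p} (P? : Decidable P) X →
    total X ≡ total (filter P? X) + total (filter (∁? P?) X)
  total-split P? [] = refl
  total-split P? (x ∷ X) with P? x
  ... | yes _ = trans (cong (g x +_) (total-split P? X)) (sym (+-assoc (g x) _ _))
  ... | no _  = trans (cong (g x +_) (total-split P? X)) (x∙yz≈y∙xz (g x) (total (filter P? X)) _)

length-split : ∀ {p} {P : ℕ → Set p} (P? : Decidable P) X →
  length X ≡ length (filter P? X) + length (filter (∁? P?) X)
length-split P? [] = refl
length-split P? (x ∷ X) with P? x
... | yes _ = cong suc (length-split P? X)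
... | no _  = trans (cong suc (length-split P? X)) (sym (+-suc _ _))

split-bound : ∀ {p} {P : ℕ → Set p} (P? : Decidable P) g j a b X →
  j * length (filter P? X) ≤ total g (filter P? X) + a →
  j * length (filter (∁? P?) X) ≤ total g (filter (∁? P?) X) + b →
  j * length X ≤ total g X + (a + b)
split-bound P? g j a b X Y-bound Z-bound = begin
  j * length X                      ≡⟨ cong (j *_) (length-split P? X) ⟩
  j * (length Y + length Z)         ≡⟨ *-distribˡ-+ j (length Y) (length Z) ⟩
  j * length Y + j * length Z       ≤⟨ +-mono-≤ Y-bound Z-bound ⟩
  (total g Y + a) + (total g Z + b) ≡⟨ medial (total g Y) a (total g Z) b ⟩
  (total g Y + total g Z) + (a + b) ≡⟨ cong (_+ (a + b)) (total-split g P? X) ⟨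
  total g X + (a + b)               ∎
  where
  open ≤-Reasoning
  Y = filter P? X
  Z = filter (∁? P?) X

-- Peel off the class of the largest label and recurse on the smaller ones; each class costs one
-- `a`. The bound is asked of every sorted list inside a class so that it passes to sublists.
total-classes : ∀ g (lab : ℕ → ℕ) j a B X → AllPairs _<_ X → (∀ {x} → x ∈ X → lab x < B) →
  (∀ i Y → AllPairs _<_ Y → (∀ {y} → y ∈ Y → y ∈ X × lab y ≡ i) → j * length Y ≤ total g Y + a) →
  j * length X ≤ total g X + B * a
total-classes g lab j a zero [] _ _ _ = ≤-trans (≤-reflexive (*-zeroʳ j)) z≤n
total-classes g lab j a zero (x ∷ X) _ lab< _ with () ← lab< (here refl)
total-classes g lab j a (suc B) X X↗ lab< class = split-bound inB? g j a (B * a) X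
  (class B _ (AllPairs.filter⁺ inB? X↗) (∈-filter⁻ inB? {xs = X}))
  (total-classes g lab j a B _ (AllPairs.filter⁺ (∁? inB?) X↗) (λ x∈ → lab<B (rest⁻ x∈))
    (λ i W W↗ W⊆ → class i W W↗ (λ y∈ → proj₁ (rest⁻ (proj₁ (W⊆ y∈))) , proj₂ (W⊆ y∈))))
  where
  inB? : Decidable (λ x → lab x ≡ B)
  inB? x = lab x ≟ B
  rest⁻ : ∀ {x} → x ∈ filter (∁? inB?) X → x ∈ X × lab x ≢ B
  rest⁻ = ∈-filter⁻ (∁? inB?) {xs = X}
  lab<B : ∀ {x} → x ∈ X × lab x ≢ B → lab x < B
  lab<B (x∈ , ≢B) = ≤∧≢⇒< (≤-pred (lab< x∈)) ≢B

indicator : ∀ {p} {P : Set p} → Dec P → ℕ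
indicator P? = if does P? then 1 else 0

total-indicator : ∀ {p} {P : ℕ → Set p} (P? : Decidable P) X →
  total (λ x → indicator (P? x)) X ≡ length (filter P? X)
total-indicator P? [] = refl
total-indicator P? (x ∷ X) with does (P? x)
... | true  = cong suc (total-indicator P? X)
... | false = total-indicator P? X

total-+ : ∀ g h X → total (λ x → g x + h x) X ≡ total g X + total h X
total-+ g h [] = refl
total-+ g h (x ∷ X) = trans (cong (g x + h x +_) (total-+ g h X)) (medial (g x) (h x) _ _)

-- A strictly sorted list has no repetitions, so each key uses up its own entry of `ps`.
length-⊆ : ∀ X ps → AllPairs _<_ X → (∀ {x} → x ∈ X → x ∈ ps) → length X ≤ length ps
length-⊆ [] ps _ _ = z≤n
length-⊆ (x ∷ X) ps (x<X ∷ X↗) X⊆ with ∈-∃++ (X⊆ (here refl))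
... | ps₁ , ps₂ , refl = begin
  suc (length X)              ≤⟨ s≤s (length-⊆ X (ps₁ ++ ps₂) X↗ avoid) ⟩
  suc (length (ps₁ ++ ps₂))   ≡⟨ ↭-length (shift x ps₁ ps₂) ⟨
  length (ps₁ ++ x ∷ ps₂)     ∎
  where
  open ≤-Reasoning
  avoid : ∀ {z} → z ∈ X → z ∈ ps₁ ++ ps₂
  avoid z∈ with ∈-resp-↭ (shift x ps₁ ps₂) (X⊆ (there z∈))
  ... | here refl = contradiction (All.lookup x<X z∈) (<-irrefl refl)
  ... | there p   = p

allPairs-map∈ : ∀ {X} {R S : ℕ → ℕ → Set} → (∀ {x y} → x ∈ X → y ∈ X → R x y → S x y) →
  AllPairs R X → AllPairs S X
allPairs-map∈ f []         = []
allPairs-map∈ f (px ∷ pxs) =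
  All.tabulate (λ y∈ → f (here refl) (there y∈) (All.lookup px y∈))
  ∷ allPairs-map∈ (λ x∈ y∈ → f (there x∈) (there y∈)) pxs

-- Counting touches along a run.

-- A linear form of the prefix-code bound: a chain of m keys is touched at least
-- j * m ∸ excess b j times in total.  The recurrence charges the first touch,
-- at which the least key is dropped (it may be the one being accessed), and
-- applies the bound for j to the at most b chains into which the rest splits.
excess : ℕ → ℕ → ℕ
excess b zero    = 0
excess b (suc j) = j + b * excess b j

module Touches (𝒜 : Algorithm) (T₀ : Tree) where

  next : List ℕ → Tree → ℕ → Tree
  next h T s = access T s (after 𝒜 T₀ h T s)

  -- The share of the run cost charged to `x`: one unit for each access whose search path contains
  -- it.
  touches : List ℕ → Tree → List ℕ → ℕ → ℕ
  touches h T []       x = 0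
  touches h T (s ∷ ss) x = indicator (x ∈? path s T) + touches (h ++ [ s ]) (next h T s) ss x

  -- Summing over accesses first, the keys of `X` counted at one access are distinct members of its
  -- search path.
  touches≤runCost : ∀ ss h T X → AllPairs _<_ X → total (touches h T ss) X ≤ runCost 𝒜 T₀ h T ss
  touches≤runCost []       h T X X↗ = ≤-reflexive (total-0 X)
    where
    total-0 : ∀ X → total (λ _ → 0) X ≡ 0
    total-0 []      = refl
    total-0 (_ ∷ X) = total-0 X
  touches≤runCost (s ∷ ss) h T X X↗ = begin
    total (touches h T (s ∷ ss)) X ≡⟨ total-+ (λ x → indicator (x ∈? path s T)) later X ⟩
    total (λ x → indicator (x ∈? path s T)) X + total later X
      ≡⟨ cong (_+ total later X) (total-indicator (_∈? path s T) X) ⟩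
    length (filter (_∈? path s T) X) + total later X
      ≤⟨ +-mono-≤ (length-⊆ _ (path s T) (AllPairs.filter⁺ (_∈? path s T) X↗)
                     (λ x∈ → proj₂ (∈-filter⁻ (_∈? path s T) {xs = X} x∈)))
                  (touches≤runCost ss (h ++ [ s ]) (next h T s) X X↗) ⟩
    runCost 𝒜 T₀ h T (s ∷ ss) ∎
    where
    open ≤-Reasoning
    later = touches (h ++ [ s ]) (next h T s) ss

module Chains (𝒜 : Algorithm) (msa : MinimallySelfAdjusting 𝒜) (T₀ : Tree) (bst : IsBST T₀)
  (C L : ℕ)
  (few : ∀ {h T} → Reach 𝒜 T₀ h T → ∀ s → s ∈ inorder T →
    MonotonePartition C s (after 𝒜 T₀ h T s) × leaves (after 𝒜 T₀ h T s) ≤ L) where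

  open Touches 𝒜 T₀

  -- Induction on the remaining accesses: one that misses the chain keeps `j`, one that touches it
  -- lowers `j`. Requiring all of `X` to be still due for access forces a touch before the accesses
  -- run out.
  chain-touches : ∀ j ss {h T} → Reach 𝒜 T₀ h T → inorder T ≡ inorder T₀ →
    AllPairs _<_ ss → (∀ {x} → x ∈ ss → x ∈ inorder T₀) →
    ∀ X → (∀ {x} → x ∈ X → x ∈ ss) → AllPairs (λ x y → Chain x y T) X →
    j * length X ≤ total (touches h T ss) X + excess (C * L) j
  chain-touches zero    ss reach inv ss↗ ss⊆ X X⊆ ch = z≤n
  chain-touches (suc j) ss reach inv ss↗ ss⊆ [] X⊆ ch = ≤-trans (≤-reflexive (*-zeroʳ (suc j))) z≤n
  chain-touches (suc j) [] reach inv ss↗ ss⊆ (x ∷ X) X⊆ ch with () ← X⊆ (here refl)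
  chain-touches (suc j) (s ∷ ss) {h} {T} reach inv (s<ss ∷ ss↗) ss⊆ (x ∷ Y) X⊆ ch@(x~Y ∷ ch-Y)
    = by-cases (x ∈? path s T)
    where
    open ≤-Reasoning
    bst-T : IsBST T
    bst-T = subst (AllPairs _<_) (sym inv) bst
    o : Ordered T
    o = ordered T bst-T
    s∈T : s ∈ inorder T
    s∈T = subst (s ∈_) (sym inv) (ss⊆ (here refl))
    Aₛ = after 𝒜 T₀ h T s
    valid : ValidAfter T s Aₛ
    valid = msa T₀ bst reach s s∈T
    fills : Fills Aₛ (hanging s T) (next h T s)
    fills = access-fills T s valid
    reach′ = Reach.step reach s s∈T
    inv′ : inorder (next h T s) ≡ inorder T₀
    inv′ = trans (inorder-access {t = T} bst-T valid) inv
    ss⊆′ : ∀ {y} → y ∈ ss → y ∈ inorder T₀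
    ss⊆′ p = ss⊆ (there p)
    later = touches (h ++ [ s ]) (next h T s) ss

    s≤ : ∀ {y} → y ∈ s ∷ ss → s ≤ y
    s≤ (here refl) = ≤-refl
    s≤ (there p)   = <⇒≤ (All.lookup s<ss p)
    X↗ : AllPairs _<_ (x ∷ Y)
    X↗ = AllPairs.map (chain⇒< o) ch
    -- Only the least key `x` can equal `s`.
    s<Y : ∀ {y} → y ∈ Y → s < y
    s<Y y∈ = ≤-<-trans (s≤ (X⊆ (here refl))) (All.lookup (AllPairs.head X↗) y∈)
    ∈ss : ∀ {y} → s < y → y ∈ s ∷ ss → y ∈ ss
    ∈ss s<y (here refl) = contradiction s<y (<-irrefl refl)
    ∈ss s<y (there p)   = p

    later≤ : ∀ X → total later X ≤ total (touches h T (s ∷ ss)) X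
    later≤ []      = z≤n
    later≤ (x ∷ X) = +-mono-≤ (m≤n+m _ (indicator (x ∈? path s T))) (later≤ X)

    touch : ∀ {y} → y ∈ path s T → touches h T (s ∷ ss) y ≡ suc (later y)
    touch {y} y∈ with y ∈? path s T
    ... | yes _ = refl
    ... | no y∉ = contradiction y∈ y∉

    touch-all : ∀ Z → (∀ {y} → y ∈ Z → y ∈ path s T) →
      length Z + total later Z ≤ total (touches h T (s ∷ ss)) Z
    touch-all [] _ = z≤n
    touch-all (z ∷ Z) Z⊆ = begin
      suc (length Z) + (later z + total later Z)
        ≡⟨ cong suc (x∙yz≈y∙xz (length Z) (later z) _) ⟩
      suc (later z) + (length Z + total later Z)
        ≤⟨ +-mono-≤ (≤-reflexive (sym (touch (Z⊆ (here refl))))) (touch-all Z (λ p → Z⊆ (there p))) ⟩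
      total (touches h T (s ∷ ss)) (z ∷ Z) ∎

    module Touched (X⊆path : ∀ {y} → y ∈ x ∷ Y → y ∈ path s T) where
      bA = proj₁ valid
      oA : Ordered Aₛ
      oA = ordered Aₛ bA
      Y⊆Aₛ : ∀ {y} → y ∈ Y → y ∈ inorder Aₛ
      Y⊆Aₛ y∈ = ∈-resp-↭ (↭-sym (proj₁ (proj₂ valid))) (X⊆path (there y∈))
      partition = few reach s s∈T
      col = proj₁ (proj₁ partition)

      same-rdepth : ∀ {y z} → y ∈ Y → z ∈ Y → col y ≡ col z → rdepth y Aₛ ≡ rdepth z Aₛ
      same-rdepth {y} {z} y∈ z∈ eq with proj₂ (proj₁ partition) (col z)
      ... | inj₁ (_ , same) = same y z (Y⊆Aₛ y∈ , >⇒≢ (s<Y y∈) , eq) (Y⊆Aₛ z∈ , >⇒≢ (s<Y z∈) , refl)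
      -- A part containing a key above `s` cannot be of the kind lying below `s`.
      ... | inj₂ (<s , _)   = contradiction (s<Y z∈) (<-asym (<s z (Y⊆Aₛ z∈ , >⇒≢ (s<Y z∈) , refl)))

      same-labels : ∀ c i Z → AllPairs _<_ Z →
        (∀ {z} → z ∈ Z → (z ∈ Y × toℕ (col z) ≡ c) × leafIndex z Aₛ ≡ i) →
        AllPairs (λ y z → Chain y z (next h T s)) Z
      same-labels c i Z Z↗ labels = allPairs-map∈ link Z↗
        where
        link : ∀ {y z} → y ∈ Z → z ∈ Z → y < z → Chain y z (next h T s)
        link y∈ z∈ y<z with labels y∈ | labels z∈
        ... | (y∈Y , cy) , iy | (z∈Y , cz) , iz = fills-chain fills
          (labels⇒chain Aₛ oA (Y⊆Aₛ y∈Y) (Y⊆Aₛ z∈Y) y<z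
            (same-rdepth y∈Y z∈Y (toℕ-injective (trans cy (sym cz)))) (trans iy (sym iz)))

      later-bound : j * length Y ≤ total later Y + C * L * excess (C * L) j
      later-bound = subst (λ n → j * length Y ≤ total later Y + n) (sym (*-assoc C L _))
        -- Split `Y` into `C` monotone parts, then each part by leaf position into `L` classes;
        -- every final class is a chain in the next tree.
        (total-classes later (λ y → toℕ (col y)) j (L * excess (C * L) j) C Y (AllPairs.tail X↗) (λ {y} _ → toℕ<n (col y))
          λ c Z Z↗ Z⊆ → total-classes later (λ y → leafIndex y Aₛ) j (excess (C * L) j) L Z Z↗
            (λ z∈ → <-≤-trans (leafIndex<leaves Aₛ oA (Y⊆Aₛ (proj₁ (Z⊆ z∈)))) (proj₂ partition))
            λ i W W↗ W⊆ → chain-touches j ss reach′ inv′ ss↗ ss⊆′ W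
              (λ w∈ → let w∈Y = proj₁ (Z⊆ (proj₁ (W⊆ w∈))) in ∈ss (s<Y w∈Y) (X⊆ (there w∈Y)))
              (same-labels c i W W↗ (λ w∈ → let w∈Z , i≡ = W⊆ w∈ in Z⊆ w∈Z , i≡)))

      bound : suc j * length (x ∷ Y) ≤ total (touches h T (s ∷ ss)) (x ∷ Y) + excess (C * L) (suc j)
      bound = begin
        -- The term `suc (length Y)` counts the present touch of every key; the lone `j` belongs to
        -- the dropped key `x` and goes into the excess.
        suc j * suc (length Y)
          ≡⟨ cong (suc (length Y) +_) (*-suc j (length Y)) ⟩
        suc (length Y) + (j + j * length Y)
          ≤⟨ +-monoʳ-≤ (suc (length Y)) (+-monoʳ-≤ j later-bound) ⟩
        suc (length Y) + (j + (total later Y + C * L * excess (C * L) j))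
          ≡⟨ cong (suc (length Y) +_) (x∙yz≈y∙xz j (total later Y) _) ⟩
        suc (length Y) + (total later Y + excess (C * L) (suc j))
          ≡⟨ +-assoc (suc (length Y)) (total later Y) _ ⟨
        suc (length Y) + total later Y + excess (C * L) (suc j)
          ≤⟨ +-monoˡ-≤ _ (+-monoʳ-≤ (suc (length Y)) (m≤n+m _ (later x))) ⟩
        length (x ∷ Y) + total later (x ∷ Y) + excess (C * L) (suc j)
          ≤⟨ +-monoˡ-≤ _ (touch-all (x ∷ Y) X⊆path) ⟩
        total (touches h T (s ∷ ss)) (x ∷ Y) + excess (C * L) (suc j) ∎

    by-cases : Dec (x ∈ path s T) →
      suc j * length (x ∷ Y) ≤ total (touches h T (s ∷ ss)) (x ∷ Y) + excess (C * L) (suc j)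
    by-cases (yes x∈) = Touched.bound λ where
      (here refl) → x∈
      (there y∈)  → chain-touched-up o (All.lookup x~Y y∈) x∈
    -- Each chained pair stays together in a hanging tree, so the same chain is handed on with the
    -- same `j`.
    by-cases (no x∉) = ≤-trans
      (chain-touches (suc j) ss reach′ inv′ ss↗ ss⊆′ (x ∷ Y) X⊆ss
        (allPairs-map∈ (λ _ y∈ c → fills-hung-chain fills (chain-untouched c (untouched y∈))) ch))
      (+-monoˡ-≤ _ (later≤ (x ∷ Y)))
      where
      -- An accessed key lies on its own search path, so `x` is not `s` and is still to come.
      s<x : s < x
      s<x = ≤∧≢⇒< (s≤ (X⊆ (here refl))) (λ where refl → x∉ (∈path s T o s∈T))
      untouched : ∀ {y} → y ∈ x ∷ Y → y ∉ path s T
      untouched (here refl) = x∉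
      untouched (there y∈) y∈path =
        x∉ (chain-touched-down o (s≤ (X⊆ (here refl))) (All.lookup x~Y y∈) y∈path)
      X⊆ss : ∀ {y} → y ∈ x ∷ Y → y ∈ ss
      X⊆ss (here refl) = ∈ss s<x (X⊆ (here refl))
      X⊆ss (there y∈)  = ∈ss (s<Y y∈) (X⊆ (there y∈))

-- The left path as initial tree.

leftPath : ℕ → Tree
leftPath zero    = leaf
leftPath (suc n) = node (leftPath n) n leaf

size-leftPath : ∀ n → size (leftPath n) ≡ n
size-leftPath zero    = refl
size-leftPath (suc n) = trans (+-comm _ 1) (cong suc (size-leftPath n))

length-inorder : ∀ t → length (inorder t) ≡ size t
length-inorder leaf         = refl
length-inorder (node l k r) = trans (length-++ (inorder l))
  (cong₂ (λ m n → m + suc n) (length-inorder l) (length-inorder r))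

leftPath-spine : ∀ n → x ∈ inorder (leftPath n) → LeftSpine x (leftPath n)
leftPath-spine (suc n) x∈ with ∈-++⁻ (inorder (leftPath n)) x∈
... | inj₁ p           = down (leftPath-spine n p)
... | inj₂ (here refl) = top

leftPath-< : ∀ n → x ∈ inorder (leftPath n) → x < n
leftPath-< (suc n) x∈ with ∈-++⁻ (inorder (leftPath n)) x∈
... | inj₁ p           = m<n⇒m<1+n (leftPath-< n p)
... | inj₂ (here refl) = n<1+n n

leftPath-bst : ∀ n → IsBST (leftPath n)
leftPath-bst zero    = []
leftPath-bst (suc n) = AllPairs.++⁺ (leftPath-bst n) ([] ∷ []) (All.tabulate λ x∈ → leftPath-< n x∈ ∷ [])

-- All keys lie on one left spine, so the whole key set starts as a single chain.
leftPath-chain : ∀ n → AllPairs (λ x y → Chain x y (leftPath n)) (inorder (leftPath n))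
leftPath-chain zero    = []
leftPath-chain (suc n) = AllPairs.++⁺ (AllPairs.map inˡ (leftPath-chain n)) ([] ∷ [])
  (All.tabulate λ x∈ → top (leftPath-spine n x∈) ∷ [])

-- Growth of the excess.

^-distribʳ-* : ∀ n a b → (a * b) ^ n ≡ a ^ n * b ^ n
^-distribʳ-* zero    a b = refl
^-distribʳ-* (suc n) a b = trans (cong (a * b *_) (^-distribʳ-* n a b)) ([m*n]*[o*p]≡[m*o]*[n*p] a b _ _)

-- Strictness of `B < b` leaves a spare copy of `j * b ^ j`, which absorbs the additive `j`; it also
-- makes `b` positive.
excess-≤ : ∀ {B b} j → B < b → excess B j ≤ j * b ^ j
excess-≤         zero    B<b = z≤n
excess-≤ {B} {b} (suc j) B<b = begin
  j + B * excess B j           ≤⟨ +-mono-≤ (m≤m*n j (b ^ j)) (*-monoʳ-≤ B (excess-≤ j B<b)) ⟩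
  suc B * (j * b ^ j)          ≤⟨ *-mono-≤ B<b (*-monoˡ-≤ (b ^ j) (n≤1+n j)) ⟩
  b * (suc j * b ^ j)          ≡⟨ *-commutes ⟩
  suc j * b ^ suc j            ∎
  where
  open ≤-Reasoning
  *-commutes : b * (suc j * b ^ j) ≡ suc j * b ^ suc j
  *-commutes = trans (sym (*-assoc b (suc j) _)) (trans (cong (_* b ^ j) (*-comm b (suc j))) (*-assoc (suc j) b _))
  instance
    b^j≢0 : NonZero (b ^ j)
    b^j≢0 = m^n≢0 b j {{>-nonZero (≤-<-trans z≤n B<b)}}

-- The excess is at most `D * M ^ j`. If `M ^ j ≤ D`, this is at most `D * D`, below `n` by choice;
-- otherwise it is below `M ^ (j + j)`, which subpolynomial growth keeps at most `n`.
excess-sublinear : ∀ C j {f} → SubPolynomial f → ∃[ n ] excess (C * f n) j < n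
-- The exponent covers a product of two powers `M ^ j`; the successor keeps it positive when `j` is
-- zero.
excess-sublinear C j {f} sub with sub (suc (j + j)) (s≤s z≤n)
... | N₀ , eventually = n , small (≤-<-connex (M ^ j) D)
  where
  open ≤-Reasoning
  D = j * suc C ^ j
  -- Beyond `N₀` for the growth condition, beyond `D * D` for the case of small `M ^ j`.
  n = suc (N₀ + D * D)
  -- The maximum with 1 keeps the base positive and yields `C * f n < suc C * M`.
  M = 1 ⊔ f n
  excess≤ : excess (C * f n) j ≤ D * M ^ j
  excess≤ = begin
    excess (C * f n) j        ≤⟨ excess-≤ j (+-mono-≤ (m≤m⊔n 1 (f n)) (*-monoʳ-≤ C (m≤n⊔m 1 (f n)))) ⟩
    j * (suc C * M) ^ j       ≡⟨ cong (j *_) (^-distribʳ-* j (suc C) M) ⟩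
    j * (suc C ^ j * M ^ j)   ≡⟨ *-assoc j _ _ ⟨
    D * M ^ j                 ∎
  M^≤n : M ^ suc (j + j) ≤ n
  M^≤n with ⊔-sel 1 (f n)
  ... | inj₁ eq = ≤-trans (≤-reflexive (trans (cong (_^ suc (j + j)) eq) (^-zeroˡ (suc (j + j))))) (s≤s z≤n)
  ... | inj₂ eq = ≤-trans (≤-reflexive (cong (_^ suc (j + j)) eq)) (eventually n (m≤n⇒m≤1+n (m≤m+n N₀ _)))
  small : M ^ j ≤ D ⊎ D < M ^ j → excess (C * f n) j < n
  small (inj₁ M^j≤D) = s≤s (≤-trans excess≤ (≤-trans (*-monoʳ-≤ D M^j≤D) (m≤n+m _ N₀)))
  small (inj₂ D<M^j) = begin-strict
    excess (C * f n) j   ≤⟨ excess≤ ⟩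
    D * M ^ j            <⟨ *-monoˡ-< (M ^ j) {{>-nonZero (≤-<-trans z≤n D<M^j)}} D<M^j ⟩
    M ^ j * M ^ j        ≡⟨ ^-distribˡ-+-* M j j ⟨
    M ^ (j + j)          ≤⟨ ^-monoʳ-≤ M {{>-nonZero (m≤m⊔n 1 (f n))}} (n≤1+n (j + j)) ⟩
    M ^ suc (j + j)      ≤⟨ M^≤n ⟩
    n                    ∎

theorem12 : (𝒜 : Algorithm) → MinimallySelfAdjusting 𝒜 →
    (C : ℕ) (f : ℕ → ℕ) → SubPolynomial f →
    (∀ T₀ → IsBST T₀ → ∀ {h T} → Reach 𝒜 T₀ h T → ∀ s → s ∈ inorder T →
    MonotonePartition C s (after 𝒜 T₀ h T s)
    × leaves (after 𝒜 T₀ h T s) ≤ f (size T₀)) →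
    ¬ SequentialAccess 𝒜
-- Taking `j` one above the assumed constant `K` and cancelling `K * n` leaves `n` at most the
-- excess, against the choice of `n`.
theorem12 𝒜 msa C f sub few (K , cheap) with excess-sublinear C (suc K) sub
... | n , excess<n = contradiction excess<n (≤⇒≯ (+-cancelˡ-≤ (K * n) n _ (begin
  K * n + n                                       ≡⟨ +-comm (K * n) n ⟩
  suc K * n                                       ≡⟨ cong (suc K *_) length-keys ⟨
  suc K * length keys                             ≤⟨ chain-touches (suc K) keys Reach.start refl bst (λ x∈ → x∈)
                                                       keys (λ x∈ → x∈) (leftPath-chain n) ⟩
  total (touches [] T₀ keys) keys + excess (C * f n) (suc K)
                                                  ≤⟨ +-monoˡ-≤ _ (≤-trans (touches≤runCost keys [] T₀ keys bst) (cheap T₀ bst)) ⟩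
  K * size T₀ + excess (C * f n) (suc K)          ≡⟨ cong (λ m → K * m + excess (C * f n) (suc K)) (size-leftPath n) ⟩
  K * n + excess (C * f n) (suc K)                ∎)))
  where
  open ≤-Reasoning
  T₀ = leftPath n
  keys = inorder T₀
  bst = leftPath-bst n
  length-keys : length keys ≡ n
  length-keys = trans (length-inorder T₀) (size-leftPath n)
  open Touches 𝒜 T₀
  open Chains 𝒜 msa T₀ bst C (f n) (λ {h} {T} reach s s∈ →
    subst (λ m → MonotonePartition C s (after 𝒜 T₀ h T s) × leaves (after 𝒜 T₀ h T s) ≤ f m)
      (size-leftPath n) (few T₀ bst reach s s∈))
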